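{- Assume the set of atoms is finite. For every $E\in\mathcal{L}({\sf par})$, the unification type of the logic ${\sf IPC}+E$ is finitary: every formula $A$ that is unifiable in ${\sf IPC}+E$ has a finite complete set of unifiers in ${\sf IPC}+E$.
   Context: The language $\mathcal{L}$ is built from atoms ${\sf atom}={\sf var}\cup{\sf par}$ (variables and parameters, disjoint) using $\bot,\wedge,\vee,\to$; here ${\sf atom}$ is assumed finite. $\mathcal{L}({\sf par})$ is the set of formulas whose atoms are all parameters. A substitution is a map $\theta:\mathcal{L}\to\mathcal{L}$ commuting with connectives with $\theta(p)=p$ for $p\in{\sf par}$; $\theta\gamma$ denotes composition. ${\sf IPC}+E$ is intuitionistic propositional logic with the single extra axiom $E$ (not as a schema); so ${\sf IPC}+E\vdash C$ iff $E\to C$ is intuitionistically provable. A unifier of $A$ in ${\sf IPC}+E$ is a substitution $\theta$ with ${\sf IPC}+E\vdash\theta(A)$; $A$ is unifiable if it has a unifier. $\gamma$ is less general than $\theta$ if there is a substitution $\lambda$ with ${\sf IPC}+E\vdash\gamma(x)\leftrightarrow\lambda\theta(x)$ for every variable $x$. A set $\Theta$ of substitutions is a complete set of unifiers of $A$ if every member unifies $A$ and every unifier of $A$ is less general than some member of $\Theta$. The unification type is finitary if every unifiable formula has a finite complete set of unifiers. -}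

module Defs where

open import Data.Nat using (ℕ)
open import Data.Fin using (Fin)
open import Data.List using (List; []; _∷_)
open import Data.List.Membership.Propositional using (_∈_)
open import Data.List.Relation.Unary.All using (All)
open import Data.List.Relation.Unary.Any using (Any)
open import Data.Product using (Σ; _×_)

data Fm (nv np : ℕ) : Set where
  var : Fin nv → Fm nv np
  par : Fin np → Fm nv np
  ⊥'  : Fm nv np
  _∧'_ : Fm nv np → Fm nv np → Fm nv np
  _∨'_ : Fm nv np → Fm nv np → Fm nv np
  _⇒_ : Fm nv np → Fm nv np → Fm nv np

infixr 6 _∧'_
infixr 5 _∨'_
infixr 4 _⇒_

module _ {nv np : ℕ} where

  _⇔_ : Fm nv np → Fm nv np → Fm nv np
  A ⇔ B = (A ⇒ B) ∧' (B ⇒ A)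

  data ParOnly : Fm nv np → Set where
    par : ∀ p → ParOnly (par p)
    ⊥'  : ParOnly ⊥'
    _∧'_ : ∀ {A B} → ParOnly A → ParOnly B → ParOnly (A ∧' B)
    _∨'_ : ∀ {A B} → ParOnly A → ParOnly B → ParOnly (A ∨' B)
    _⇒_ : ∀ {A B} → ParOnly A → ParOnly B → ParOnly (A ⇒ B)

  infix 2 _⊢_
  data _⊢_ (Γ : List (Fm nv np)) : Fm nv np → Set where
    hyp  : ∀ {A} → A ∈ Γ → Γ ⊢ A
    ⊥E   : ∀ {A} → Γ ⊢ ⊥' → Γ ⊢ A
    ∧I   : ∀ {A B} → Γ ⊢ A → Γ ⊢ B → Γ ⊢ A ∧' B
    ∧E₁  : ∀ {A B} → Γ ⊢ A ∧' B → Γ ⊢ A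
    ∧E₂  : ∀ {A B} → Γ ⊢ A ∧' B → Γ ⊢ B
    ∨I₁  : ∀ {A B} → Γ ⊢ A → Γ ⊢ A ∨' B
    ∨I₂  : ∀ {A B} → Γ ⊢ B → Γ ⊢ A ∨' B
    ∨E   : ∀ {A B C} → Γ ⊢ A ∨' B → (A ∷ Γ) ⊢ C → (B ∷ Γ) ⊢ C → Γ ⊢ C
    ⇒I   : ∀ {A B} → (A ∷ Γ) ⊢ B → Γ ⊢ A ⇒ B
    ⇒E   : ∀ {A B} → Γ ⊢ A ⇒ B → Γ ⊢ A → Γ ⊢ B

  IPC⊢ : Fm nv np → Set
  IPC⊢ A = [] ⊢ A

  -- IPC + E ⊢ C  iff  IPC ⊢ E → C   (E a single extra axiom, not a schema)
  IPC+_⊢_ : Fm nv np → Fm nv np → Set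
  IPC+ E ⊢ C = IPC⊢ (E ⇒ C)

  Subst : Set
  Subst = Fin nv → Fm nv np

  apply : Subst → Fm nv np → Fm nv np
  apply θ (var x)  = θ x
  apply θ (par p)  = par p
  apply θ ⊥'       = ⊥'
  apply θ (A ∧' B) = apply θ A ∧' apply θ B
  apply θ (A ∨' B) = apply θ A ∨' apply θ B
  apply θ (A ⇒ B)  = apply θ A ⇒ apply θ B

  _∘ˢ_ : Subst → Subst → Subst
  (λ' ∘ˢ θ) x = apply λ' (θ x)

  Unifier : Fm nv np → Fm nv np → Subst → Set
  Unifier E A θ = IPC+ E ⊢ apply θ A

  Unifiable : Fm nv np → Fm nv np → Set
  Unifiable E A = Σ Subst (Unifier E A)

  LessGeneral : Fm nv np → Subst → Subst → Set
  LessGeneral E γ θ = Σ Subst λ λ' → ∀ x → IPC+ E ⊢ (γ x ⇔ (λ' ∘ˢ θ) x)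

  CompleteSet : Fm nv np → Fm nv np → List Subst → Set
  CompleteSet E A Θ =
    All (Unifier E A) Θ ×
    (∀ γ → Unifier E A γ → Any (LessGeneral E γ) Θ)

  Finitary : Fm nv np → Set
  Finitary E = ∀ A → Unifiable E A → Σ (List Subst) (CompleteSet E A)

{-# OPTIONS --safe #-}

-- Let X be the set of subformulas of A and E together with all atoms.  A unifier γ determines
-- the set Q of those t ⊆ X for which E proves γ(⋀ t → ⋁ (X ∖ t)), hence the formula B, the
-- conjunction of ⋀ t → ⋁ (X ∖ t) over t ∈ Q.  Modulo E, γ unifies B and B implies A.  Moreover
-- B is projective.  Every X-theory outside Q is that of a model of E under γ; gluing such models
-- to a new root shows that a root of a model of E whose proper successors force B can be made to
-- force B by changing only its variables.  Ghilardi's substitutions σ a perform this change,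
-- and iterating them over all a yields a unifier of B which is the identity modulo B, hence
-- more general than γ.  The number of iterations is bounded in terms of X alone, because a point
-- still not forcing B after i rounds sees at least i items among the X-theories of B-points
-- above it and the parameters it does not force.  There are only finitely many Q ⊆ 2^X, and
-- decidability of IPC selects those whose substitution unifies A.
module Submission where

open import Defs
open import Data.Bool using (Bool; true; false; T)
open import Data.Empty using (⊥; ⊥-elim)
open import Data.Fin using (Fin)
import Data.Fin.Properties as Fin
open import Data.List using (List; []; _∷_; _++_; map; filter; foldr; length; allFin)
open import Data.List.Membership.Propositional using (_∈_; _∉_; find; lose)
open import Data.List.Membership.Propositional.Properties
  using (∈-++⁺ˡ; ∈-++⁺ʳ; ∈-++⁻; ∈-map⁺; ∈-map⁻; ∈-filter⁺; ∈-filter⁻; ∈-allFin)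
import Data.List.Membership.DecPropositional as DecMembership
open import Data.List.Properties using (length-filter)
open import Data.List.Relation.Binary.Subset.Propositional using (_⊆_)
open import Data.List.Relation.Binary.Subset.Propositional.Properties
  using (xs⊆xs++ys; xs⊆ys++xs; ∷⁺ʳ; Any-resp-⊆)
open import Data.List.Relation.Unary.All as All using (All; []; _∷_)
import Data.List.Relation.Unary.All.Properties as All
open import Data.List.Relation.Unary.Any as Any using (Any; here; there)
open import Data.Nat using (ℕ; zero; suc; _≤_; _<_; z≤n; s≤s; _<?_)
open import Data.Nat.Properties using (≤-refl; ≤-trans; <-≤-trans; <-irrefl; m≤n⇒m≤1+n)
open import Data.Product using (Σ; _×_; _,_; proj₁; proj₂; map₂)
open import Data.Sum using (_⊎_; inj₁; inj₂; [_,_]′)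
open import Data.Unit using (⊤; tt)
open import Function using (_∘_; id; Equivalence; mk⇔) renaming (_⇔_ to _⟺_)
open import Function.Construct.Identity using (⇔-id)
open import Function.Construct.Symmetry using () renaming (⇔-sym to ⟺-sym)
open import Function.Properties.Equivalence using () renaming (trans to ⟺-trans)
open import Relation.Binary using (DecidableEquality)
open import Relation.Binary.PropositionalEquality using (_≡_; refl; sym; subst; cong; cong₂)
open import Relation.Nullary using (¬_; Dec; yes; no; does; ¬?; contradiction)
open import Relation.Nullary.Decidable
  using (map′; ⌊_⌋; _×-dec_; _⊎-dec_; _→-dec_; toWitness; fromWitness; T?; decidable-stable)
open import Relation.Unary using (Decidable)

open Equivalence using (to; from)

-- Finite power sets and counting by filters.

module _ {A : Set} where

  subsets : List A → List (List A)
  subsets []       = [] ∷ []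
  subsets (x ∷ xs) = map (x ∷_) (subsets xs) ++ subsets xs

  filter∈subsets : ∀ {P : A → Set} (P? : Decidable P) xs → filter P? xs ∈ subsets xs
  filter∈subsets P? []       = here refl
  filter∈subsets P? (x ∷ xs) with does (P? x)
  ... | true  = ∈-++⁺ˡ (∈-map⁺ (x ∷_) (filter∈subsets P? xs))
  ... | false = ∈-++⁺ʳ (map (x ∷_) (subsets xs)) (filter∈subsets P? xs)

  module _ {P Q : A → Set} (P? : Decidable P) (Q? : Decidable Q) (P⇒Q : ∀ x → P x → Q x) where

    length-filter-mono : ∀ xs → length (filter P? xs) ≤ length (filter Q? xs)
    length-filter-mono []       = z≤n
    length-filter-mono (x ∷ xs) with P? x | Q? x
    ... | yes p | yes q = s≤s (length-filter-mono xs)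
    ... | yes p | no ¬q = contradiction (P⇒Q x p) ¬q
    ... | no ¬p | yes q = m≤n⇒m≤1+n (length-filter-mono xs)
    ... | no ¬p | no ¬q = length-filter-mono xs

    length-filter-strict : ∀ {x} xs → x ∈ xs → Q x → ¬ P x → length (filter P? xs) < length (filter Q? xs)
    length-filter-strict (x ∷ xs) x∈ q ¬p with P? x | Q? x | x∈
    ... | yes p | _      | here refl = contradiction p ¬p
    ... | no _  | no ¬q  | here refl = contradiction q ¬q
    ... | no _  | yes _  | here refl = s≤s (length-filter-mono xs)
    ... | yes p | no ¬q  | there _   = contradiction (P⇒Q x p) ¬q
    ... | yes _ | yes _  | there x∈′ = s≤s (length-filter-strict xs x∈′ q ¬p)
    ... | no _  | yes _  | there x∈′ = m≤n⇒m≤1+n (length-filter-strict xs x∈′ q ¬p)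
    ... | no _  | no _   | there x∈′ = length-filter-strict xs x∈′ q ¬p

-- Kripke semantics

module _ {nv np : ℕ} where

  private
    Form = Fm nv np

  infix 4 _≟_
  _≟_ : DecidableEquality Form
  var x ≟ var y = map′ (cong var) (λ { refl → refl }) (x Fin.≟ y)
  par p ≟ par q = map′ (cong par) (λ { refl → refl }) (p Fin.≟ q)
  ⊥' ≟ ⊥' = yes refl
  (A ∧' B) ≟ (C ∧' D) = map′ (λ { (refl , refl) → refl }) (λ { refl → refl , refl }) (A ≟ C ×-dec B ≟ D)
  (A ∨' B) ≟ (C ∨' D) = map′ (λ { (refl , refl) → refl }) (λ { refl → refl , refl }) (A ≟ C ×-dec B ≟ D)
  (A ⇒ B) ≟ (C ⇒ D) = map′ (λ { (refl , refl) → refl }) (λ { refl → refl , refl }) (A ≟ C ×-dec B ≟ D)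
  var _ ≟ par _ = no λ ()
  var _ ≟ ⊥' = no λ ()
  var _ ≟ (_ ∧' _) = no λ ()
  var _ ≟ (_ ∨' _) = no λ ()
  var _ ≟ (_ ⇒ _) = no λ ()
  par _ ≟ var _ = no λ ()
  par _ ≟ ⊥' = no λ ()
  par _ ≟ (_ ∧' _) = no λ ()
  par _ ≟ (_ ∨' _) = no λ ()
  par _ ≟ (_ ⇒ _) = no λ ()
  ⊥' ≟ var _ = no λ ()
  ⊥' ≟ par _ = no λ ()
  ⊥' ≟ (_ ∧' _) = no λ ()
  ⊥' ≟ (_ ∨' _) = no λ ()
  ⊥' ≟ (_ ⇒ _) = no λ ()
  (_ ∧' _) ≟ var _ = no λ ()
  (_ ∧' _) ≟ par _ = no λ ()
  (_ ∧' _) ≟ ⊥' = no λ ()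
  (_ ∧' _) ≟ (_ ∨' _) = no λ ()
  (_ ∧' _) ≟ (_ ⇒ _) = no λ ()
  (_ ∨' _) ≟ var _ = no λ ()
  (_ ∨' _) ≟ par _ = no λ ()
  (_ ∨' _) ≟ ⊥' = no λ ()
  (_ ∨' _) ≟ (_ ∧' _) = no λ ()
  (_ ∨' _) ≟ (_ ⇒ _) = no λ ()
  (_ ⇒ _) ≟ var _ = no λ ()
  (_ ⇒ _) ≟ par _ = no λ ()
  (_ ⇒ _) ≟ ⊥' = no λ ()
  (_ ⇒ _) ≟ (_ ∧' _) = no λ ()
  (_ ⇒ _) ≟ (_ ∨' _) = no λ ()

  open DecMembership _≟_ using (_∈?_)

  data Tree : Set where
    node : (Fin nv → Bool) → (Fin np → Bool) → List Tree → Tree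

  infix 4 _≽_
  infix 3.5 _⊩_ _⊩?_

  data _≽_ (u : Tree) : Tree → Set where
    here  : u ≽ u
    there : ∀ {v q t ts} → t ∈ ts → u ≽ t → u ≽ node v q ts

  ≽-trans : ∀ {u v w} → u ≽ v → v ≽ w → u ≽ w
  ≽-trans p here        = p
  ≽-trans p (there m q) = there m (≽-trans p q)

  varAt : Fin nv → Tree → Bool
  varAt x (node v _ _) = v x

  parAt : Fin np → Tree → Bool
  parAt p (node _ q _) = q p

  -- The labels of a tree need not be monotone: forcing an atom quantifies over all points above.
  _⊩_ : Tree → Form → Set
  w ⊩ var x    = ∀ u → u ≽ w → T (varAt x u)
  w ⊩ par p    = ∀ u → u ≽ w → T (parAt p u)
  w ⊩ ⊥'       = ⊥
  w ⊩ (C ∧' D) = w ⊩ C × w ⊩ D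
  w ⊩ (C ∨' D) = w ⊩ C ⊎ w ⊩ D
  w ⊩ (C ⇒ D)  = ∀ u → u ≽ w → u ⊩ C → u ⊩ D

  persist : ∀ D {u w} → u ≽ w → w ⊩ D → u ⊩ D
  persist (var x)  p f         = λ z q → f z (≽-trans q p)
  persist (par x)  p f         = λ z q → f z (≽-trans q p)
  persist (C ∧' D) p (f , g)   = persist C p f , persist D p g
  persist (C ∨' D) p (inj₁ f)  = inj₁ (persist C p f)
  persist (C ∨' D) p (inj₂ g)  = inj₂ (persist D p g)
  persist (C ⇒ D)  p f         = λ z q → f z (≽-trans q p)

  points  : Tree → List Tree
  points* : List Tree → List Tree
  points (node v q ts) = node v q ts ∷ points* ts
  points* []       = []
  points* (t ∷ ts) = points t ++ points* ts

  points⁺  : ∀ {u w} → u ≽ w → u ∈ points w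
  points*⁺ : ∀ {u t ts} → t ∈ ts → u ≽ t → u ∈ points* ts
  points⁺ {node _ _ _} here = here refl
  points⁺ (there m p)       = there (points*⁺ m p)
  points*⁺ (here refl) p                = ∈-++⁺ˡ (points⁺ p)
  points*⁺ {ts = t ∷ _} (there m) p = ∈-++⁺ʳ (points t) (points*⁺ m p)

  points⁻  : ∀ w {u} → u ∈ points w → u ≽ w
  points*⁻ : ∀ ts {u} → u ∈ points* ts → Σ Tree λ t → t ∈ ts × u ≽ t
  points⁻ (node v q ts) (here refl) = here
  points⁻ (node v q ts) (there m)   = let _ , m′ , p = points*⁻ ts m in there m′ p
  points*⁻ (t ∷ ts) m with ∈-++⁻ (points t) m
  ... | inj₁ m₁ = t , here refl , points⁻ t m₁
  ... | inj₂ m₂ = let s , s∈ , p = points*⁻ ts m₂ in s , there s∈ , p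

  all≽? : ∀ {P : Tree → Set} → Decidable P → ∀ w → Dec (∀ u → u ≽ w → P u)
  all≽? P? w = map′ (λ a u p → All.lookup a (points⁺ p))
                    (λ f → All.tabulate λ {u} m → f u (points⁻ w m))
                    (All.all? P? (points w))

  any≽? : ∀ {P : Tree → Set} → Decidable P → ∀ w → Dec (Σ Tree λ u → u ≽ w × P u)
  any≽? P? w = map′ (λ a → let u , m , p = find a in u , points⁻ w m , p)
                    (λ { (u , q , p) → lose (points⁺ q) p })
                    (Any.any? P? (points w))

  _⊩?_ : ∀ w D → Dec (w ⊩ D)
  w ⊩? var x    = all≽? (λ u → T? (varAt x u)) w
  w ⊩? par p    = all≽? (λ u → T? (parAt p u)) w
  w ⊩? ⊥'       = no λ ()
  w ⊩? (C ∧' D) = (w ⊩? C) ×-dec (w ⊩? D)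
  w ⊩? (C ∨' D) = (w ⊩? C) ⊎-dec (w ⊩? D)
  w ⊩? (C ⇒ D)  = all≽? (λ u → (u ⊩? C) →-dec (u ⊩? D)) w

  sound : ∀ {Γ : List Form} {D} → Γ ⊢ D → ∀ w → All (w ⊩_) Γ → w ⊩ D
  sound (hyp m)    w ρ = All.lookup ρ m
  sound (⊥E d)     w ρ = ⊥-elim (sound d w ρ)
  sound (∧I d e)   w ρ = sound d w ρ , sound e w ρ
  sound (∧E₁ d)    w ρ = proj₁ (sound d w ρ)
  sound (∧E₂ d)    w ρ = proj₂ (sound d w ρ)
  sound (∨I₁ d)    w ρ = inj₁ (sound d w ρ)
  sound (∨I₂ d)    w ρ = inj₂ (sound d w ρ)
  sound (∨E d e f) w ρ = [ (λ c → sound e w (c ∷ ρ)) , (λ c → sound f w (c ∷ ρ)) ]′ (sound d w ρ)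
  sound (⇒I d)     w ρ = λ u p c → sound d u (c ∷ All.map (λ {D} → persist D p) ρ)
  sound (⇒E d e)   w ρ = sound d w ρ w here (sound e w ρ)

  weaken : ∀ {Γ Δ : List Form} {D} → Γ ⊆ Δ → Γ ⊢ D → Δ ⊢ D
  weaken s (hyp m)    = hyp (s m)
  weaken s (⊥E d)     = ⊥E (weaken s d)
  weaken s (∧I d e)   = ∧I (weaken s d) (weaken s e)
  weaken s (∧E₁ d)    = ∧E₁ (weaken s d)
  weaken s (∧E₂ d)    = ∧E₂ (weaken s d)
  weaken s (∨I₁ d)    = ∨I₁ (weaken s d)
  weaken s (∨I₂ d)    = ∨I₂ (weaken s d)
  weaken s (∨E d e f) = ∨E (weaken s d) (weaken (∷⁺ʳ _ s) e) (weaken (∷⁺ʳ _ s) f)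
  weaken s (⇒I d)     = ⇒I (weaken (∷⁺ʳ _ s) d)
  weaken s (⇒E d e)   = ⇒E (weaken s d) (weaken s e)

  ⋁ ⋀ : List Form → Form
  ⋁ = foldr _∨'_ ⊥'
  ⋀ = foldr _∧'_ (⊥' ⇒ ⊥')

  ⋁I : ∀ {Γ D Δ} → D ∈ Δ → Γ ⊢ D → Γ ⊢ ⋁ Δ
  ⋁I (here refl) d = ∨I₁ d
  ⋁I (there m)   d = ∨I₂ (⋁I m d)

  ⋁E : ∀ {Γ G} Δ → Γ ⊢ ⋁ Δ → (∀ {D} → D ∈ Δ → (D ∷ Γ) ⊢ G) → Γ ⊢ G
  ⋁E []      d e = ⊥E d
  ⋁E (D ∷ Δ) d e = ∨E d (e (here refl))
    (⋁E Δ (hyp (here refl)) λ m → weaken (∷⁺ʳ _ there) (e (there m)))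

  -- Decidability and completeness

  -- Either a derivation or an explicit finite countermodel; deciding which of the two arises yields
  -- decidability and completeness at once.
  Verdict : List Form → List Form → Set
  Verdict Γ Δ = (Γ ⊢ ⋁ Δ) ⊎ Σ Tree λ w → All (w ⊩_) Γ × All (λ D → ¬ w ⊩ D) Δ

  children : Form → List Form
  children (var _)  = []
  children (par _)  = []
  children ⊥'       = []
  children (C ∧' D) = C ∷ D ∷ []
  children (C ∨' D) = C ∷ D ∷ []
  children (C ⇒ D)  = C ∷ D ∷ []

  Closed : List Form → Set
  Closed X = ∀ {D} → D ∈ X → children D ⊆ X

  ++-closed : ∀ {X Y} → Closed X → Closed Y → Closed (X ++ Y)
  ++-closed {X} cX cY m c = [ (λ m₁ → ∈-++⁺ˡ (cX m₁ c)) , (λ m₂ → ∈-++⁺ʳ X (cY m₂ c)) ]′ (∈-++⁻ X m)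

  subs : Form → List Form
  subs D@(var _)  = D ∷ []
  subs D@(par _)  = D ∷ []
  subs D@⊥'       = D ∷ []
  subs D@(A ∧' B) = D ∷ subs A ++ subs B
  subs D@(A ∨' B) = D ∷ subs A ++ subs B
  subs D@(A ⇒ B)  = D ∷ subs A ++ subs B

  self∈subs : ∀ D → D ∈ subs D
  self∈subs (var _)  = here refl
  self∈subs (par _)  = here refl
  self∈subs ⊥'       = here refl
  self∈subs (_ ∧' _) = here refl
  self∈subs (_ ∨' _) = here refl
  self∈subs (_ ⇒ _)  = here refl

  private
    both⊆ : ∀ A B → A ∷ B ∷ [] ⊆ subs A ++ subs B
    both⊆ A B (here refl)         = ∈-++⁺ˡ (self∈subs A)
    both⊆ A B (there (here refl)) = ∈-++⁺ʳ (subs A) (self∈subs B)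

  subs-closed : ∀ D → Closed (subs D)
  subs-closed (var _)  (here refl) ()
  subs-closed (par _)  (here refl) ()
  subs-closed ⊥'       (here refl) ()
  subs-closed (A ∧' B) (here refl) c = there (both⊆ A B c)
  subs-closed (A ∨' B) (here refl) c = there (both⊆ A B c)
  subs-closed (A ⇒ B)  (here refl) c = there (both⊆ A B c)
  subs-closed (A ∧' B) (there m)   c = there (++-closed (subs-closed A) (subs-closed B) m c)
  subs-closed (A ∨' B) (there m)   c = there (++-closed (subs-closed A) (subs-closed B) m c)
  subs-closed (A ⇒ B)  (there m)   c = there (++-closed (subs-closed A) (subs-closed B) m c)

  outside : List Form → List Form → List Form
  outside X t = filter (λ D → ¬? (D ∈? t)) X

  outside⁺ : ∀ {X t D} → D ∈ X → D ∉ t → D ∈ outside X t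
  outside⁺ {X} {t} = ∈-filter⁺ (λ D → ¬? (D ∈? t))

  outside⁻ : ∀ X t {D} → D ∈ outside X t → D ∈ X × D ∉ t
  outside⁻ X t = ∈-filter⁻ (λ D → ¬? (D ∈? t)) {xs = X}

  module Saturation (X : List Form) (closed : Closed X) where

    -- Lindenbaum construction: each formula of `rest` is tried on the left, then on the right, and
    -- if both sides yield derivations a cut on it joins them. Once `rest` is empty, `cover` puts
    -- all of `X` outside `Γ` into `Δ`, so a verdict on the full partition settles the sequent.
    split : (rest Γ Δ : List Form) → (∀ t → Γ ⊆ t → t ⊆ X → Verdict t (outside X t)) →
            Γ ⊆ X → Δ ⊆ X → rest ⊆ X → (∀ {D} → D ∈ X → D ∈ Γ ⊎ D ∈ Δ ⊎ D ∈ rest) → Verdict Γ Δ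
    split [] Γ Δ oracle Γ⊆X Δ⊆X _ cover with Any.any? (_∈? Γ) Δ
    ... | yes a = let _ , m , h = find a in inj₁ (⋁I m (hyp h))
    ... | no ¬a with oracle Γ id Γ⊆X
    ...   | inj₁ d = inj₁ (⋁E _ d λ m → ⋁I (inΔ (outside⁻ X Γ m)) (hyp (here refl)))
      where
      inΔ : ∀ {D} → D ∈ X × D ∉ Γ → D ∈ Δ
      inΔ (m , ¬h) with cover m
      ... | inj₁ h        = contradiction h ¬h
      ... | inj₂ (inj₁ h) = h
    ...   | inj₂ (w , f , g) = inj₂ (w , f , All.tabulate λ m →
              All.lookup g (outside⁺ (Δ⊆X m) λ h → ¬a (lose m h)))
    split (D ∷ rest) Γ Δ oracle Γ⊆X Δ⊆X r⊆X cover
      with split rest (D ∷ Γ) Δ (λ t s → oracle t (s ∘ there))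
             (λ { (here refl) → r⊆X (here refl) ; (there m) → Γ⊆X m }) Δ⊆X (r⊆X ∘ there)
             (λ m → [ inj₁ ∘ there , [ inj₂ ∘ inj₁ ,
                 (λ { (here refl) → inj₁ (here refl) ; (there h) → inj₂ (inj₂ h) }) ]′ ]′ (cover m))
    ... | inj₂ (w , (_ ∷ f) , g) = inj₂ (w , f , g)
    ... | inj₁ d
      with split rest Γ (D ∷ Δ) oracle Γ⊆X
             (λ { (here refl) → r⊆X (here refl) ; (there m) → Δ⊆X m }) (r⊆X ∘ there)
             (λ m → [ inj₁ , [ inj₂ ∘ inj₁ ∘ there ,
                 (λ { (here refl) → inj₂ (inj₁ (here refl)) ; (there h) → inj₂ (inj₂ h) }) ]′ ]′ (cover m))
    ... | inj₁ e = inj₁ (∨E e d (hyp (here refl)))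
    ... | inj₂ (w , f , (_ ∷ g)) = inj₂ (w , f , g)

    -- What the truth lemma needs at one formula for a new root with theory `t` over the trees `ts`.
    -- An implication missing from `t` fails either at the root itself or in one of these trees.
    Local : List Form → List Tree → Form → Set
    Local t ts (var _)  = ⊤
    Local t ts (par _)  = ⊤
    Local t ts ⊥'       = ⊥' ∉ t
    Local t ts (C ∧' D) = (C ∧' D) ∈ t ⟺ (C ∈ t × D ∈ t)
    Local t ts (C ∨' D) = (C ∨' D) ∈ t ⟺ (C ∈ t ⊎ D ∈ t)
    Local t ts (C ⇒ D)  = ((C ⇒ D) ∈ t → C ∈ t → D ∈ t) ×
                          ((C ⇒ D) ∉ t → (C ∈ t × D ∉ t) ⊎ Any (λ s → ¬ s ⊩ C ⇒ D) ts)

    Local-mono : ∀ {t ts ts′} → ts ⊆ ts′ → ∀ D → Local t ts D → Local t ts′ D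
    Local-mono s (var _)  l = l
    Local-mono s (par _)  l = l
    Local-mono s ⊥'       l = l
    Local-mono s (_ ∧' _) l = l
    Local-mono s (_ ∨' _) l = l
    Local-mono s (_ ⇒ _)  (l , r) = l , λ ¬h → [ inj₁ , inj₂ ∘ Any-resp-⊆ s ]′ (r ¬h)

    Witnessed : List Form → (List Tree → Set) → Set
    Witnessed t P = (t ⊢ ⋁ (outside X t)) ⊎ Σ (List Tree) λ ts → All (λ s → All (s ⊩_) t) ts × P ts

    -- Extra trees never spoil a local condition, so the witnesses for the separate formulas can
    -- simply be concatenated.
    all-witnessed : ∀ {t} Y → (∀ {D} → D ∈ Y → Witnessed t (λ ts → Local t ts D)) →
                    Witnessed t (λ ts → All (Local t ts) Y)
    all-witnessed []      f = inj₂ ([] , [] , [])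
    all-witnessed (D ∷ Y) f with f (here refl) | all-witnessed Y (f ∘ there)
    ... | inj₁ d | _ = inj₁ d
    ... | inj₂ _ | inj₁ d = inj₁ d
    ... | inj₂ (ts , g , l) | inj₂ (ts′ , g′ , ls) =
      inj₂ (ts ++ ts′ , All.++⁺ g g′ ,
            (Local-mono (xs⊆xs++ys ts ts′) D l ∷ All.map (λ {C} → Local-mono (xs⊆ys++xs ts′ ts) C) ls))

    module _ (t : List Form)
             (oracle : ∀ t′ → t ⊆ t′ → t′ ⊆ X → ∀ {C} → C ∈ X → C ∉ t → C ∈ t′ → Verdict t′ (outside X t′))
             (t⊆X : t ⊆ X) where

      grab : ∀ {D} → D ∈ X → t ⊢ D → (t ⊢ ⋁ (outside X t)) ⊎ D ∈ t
      grab {D} m d with D ∈? t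
      ... | yes h = inj₂ h
      ... | no ¬h  = inj₁ (⋁I (outside⁺ m ¬h) d)

      leaf : ∀ {P : List Tree → Set} → P [] → Witnessed t P
      leaf p = inj₂ ([] , [] , p)

      -- Wherever `t` violates a local condition, it derives a formula of `X` that it omits, or is
      -- inconsistent, or contains a disjunction without either disjunct; each case proves the
      -- disjunction of the omitted formulas.
      local? : ∀ D → D ∈ X → Witnessed t (λ ts → Local t ts D)
      local? (var _) m = leaf tt
      local? (par _) m = leaf tt
      local? ⊥' m with ⊥' ∈? t
      ... | yes h = inj₁ (⊥E (hyp h))
      ... | no ¬h  = leaf ¬h
      local? (C ∧' D) m with (C ∧' D) ∈? t
      ... | yes h with grab (closed m (here refl)) (∧E₁ (hyp h)) | grab (closed m (there (here refl))) (∧E₂ (hyp h))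
      ...   | inj₁ d | _ = inj₁ d
      ...   | inj₂ _ | inj₁ d = inj₁ d
      ...   | inj₂ c | inj₂ d = leaf (mk⇔ (λ _ → c , d) (λ _ → h))
      local? (C ∧' D) m | no ¬h with C ∈? t | D ∈? t
      ...   | yes c | yes d = inj₁ (⋁I (outside⁺ m ¬h) (∧I (hyp c) (hyp d)))
      ...   | yes _ | no ¬d = leaf (mk⇔ (λ h → contradiction h ¬h) (λ p → contradiction (proj₂ p) ¬d))
      ...   | no ¬c | _     = leaf (mk⇔ (λ h → contradiction h ¬h) (λ p → contradiction (proj₁ p) ¬c))
      local? (C ∨' D) m with C ∈? t | D ∈? t
      ... | yes c | _ with grab m (∨I₁ (hyp c))
      ...   | inj₁ d = inj₁ d
      ...   | inj₂ h = leaf (mk⇔ (λ _ → inj₁ c) (λ _ → h))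
      local? (C ∨' D) m | no _ | yes d with grab m (∨I₂ (hyp d))
      ...   | inj₁ d′ = inj₁ d′
      ...   | inj₂ h  = leaf (mk⇔ (λ _ → inj₂ d) (λ _ → h))
      local? (C ∨' D) m | no ¬c | no ¬d with (C ∨' D) ∈? t
      ...   | yes h = inj₁ (∨E (hyp h) (⋁I (outside⁺ (closed m (here refl)) ¬c) (hyp (here refl)))
                                       (⋁I (outside⁺ (closed m (there (here refl))) ¬d) (hyp (here refl))))
      ...   | no ¬h  = leaf (mk⇔ (λ h → contradiction h ¬h)
                                [ (λ c → contradiction c ¬c) , (λ d → contradiction d ¬d) ]′)
      local? (C ⇒ D) m with (C ⇒ D) ∈? t
      ... | yes h with C ∈? t
      ...   | no ¬c = leaf ((λ _ c → contradiction c ¬c) , λ ¬h → contradiction h ¬h)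
      ...   | yes c with grab (closed m (there (here refl))) (⇒E (hyp h) (hyp c))
      ...     | inj₁ d = inj₁ d
      ...     | inj₂ d = leaf ((λ _ _ → d) , λ ¬h → contradiction h ¬h)
      local? (C ⇒ D) m | no ¬h with C ∈? t | D ∈? t
      ...   | _     | yes d = inj₁ (⋁I (outside⁺ m ¬h) (⇒I (hyp (there d))))
      ...   | yes c | no ¬d = leaf ((λ h → contradiction h ¬h) , λ _ → inj₁ (c , ¬d))
      ...   | no ¬c | no ¬d
        -- A refuting tree must force `t` and `C` but not `D`. Since `C` is new, every theory that
        -- the search meets properly extends `t`, so the oracle applies.
        with split X (C ∷ t) (D ∷ []) (λ t′ s s′ → oracle t′ (s ∘ there) s′ (closed m (here refl)) ¬c (s (here refl)))
               (λ { (here refl) → closed m (here refl) ; (there h) → t⊆X h })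
               (λ { (here refl) → closed m (there (here refl)) }) id (inj₂ ∘ inj₂)
      ...     | inj₁ d = inj₁ (⋁I (outside⁺ m ¬h) (⇒I (∨E d (hyp (here refl)) (⊥E (hyp (here refl))))))
      ...     | inj₂ (s , (c ∷ f) , (¬d ∷ [])) =
        inj₂ (s ∷ [] , f ∷ [] , (λ h → contradiction h ¬h) , λ _ → inj₂ (here λ g → ¬d (g s here c)))

      root : List Tree → Tree
      root = node (λ x → ⌊ var x ∈? t ⌋) (λ p → ⌊ par p ∈? t ⌋)

      truth : ∀ {ts} → All (λ s → All (s ⊩_) t) ts → All (Local t ts) X → ∀ D → D ∈ X → (root ts ⊩ D) ⟺ D ∈ t
      truth {ts} gs ls = go
        where
        above : ∀ {D s} → D ∈ t → s ∈ ts → s ⊩ D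
        above d m = All.lookup (All.lookup gs m) d

        go : ∀ D → D ∈ X → (root ts ⊩ D) ⟺ D ∈ t
        go (var x) m = mk⇔ (λ f → toWitness (f _ here))
          λ h → λ { _ here → fromWitness h ; u (there s∈ q) → above h s∈ u q }
        go (par p) m = mk⇔ (λ f → toWitness (f _ here))
          λ h → λ { _ here → fromWitness h ; u (there s∈ q) → above h s∈ u q }
        go ⊥' m = mk⇔ ⊥-elim (All.lookup ls m)
        go (C ∧' D) m = mk⇔
          (λ (c , d) → from (All.lookup ls m) (to (go C (closed m (here refl))) c , to (go D (closed m (there (here refl)))) d))
          (λ h → let c , d = to (All.lookup ls m) h in
                 from (go C (closed m (here refl))) c , from (go D (closed m (there (here refl)))) d)
        go (C ∨' D) m = mk⇔
          (λ { (inj₁ c) → from (All.lookup ls m) (inj₁ (to (go C (closed m (here refl))) c))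
             ; (inj₂ d) → from (All.lookup ls m) (inj₂ (to (go D (closed m (there (here refl)))) d)) })
          (λ h → [ inj₁ ∘ from (go C (closed m (here refl))) , inj₂ ∘ from (go D (closed m (there (here refl)))) ]′
                   (to (All.lookup ls m) h))
        go (C ⇒ D) m = mk⇔ fwd
          λ h → λ { _ here c → from (go D (closed m (there (here refl))))
                                 (proj₁ (All.lookup ls m) h (to (go C (closed m (here refl))) c))
                  ; u (there s∈ q) → above h s∈ u q }
          where
          fwd : root ts ⊩ C ⇒ D → (C ⇒ D) ∈ t
          fwd f with (C ⇒ D) ∈? t
          ... | yes h = h
          ... | no ¬h with proj₂ (All.lookup ls m) ¬h
          ...   | inj₁ (c , ¬d) = contradiction
            (to (go D (closed m (there (here refl)))) (f _ here (from (go C (closed m (here refl))) c))) ¬d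
          ...   | inj₂ a = let s , s∈ , ¬f = find a in ⊥-elim (¬f (persist (C ⇒ D) (there s∈ here) f))

      saturate-step : Verdict t (outside X t)
      saturate-step with all-witnessed X (λ {D} → local? D)
      ... | inj₁ d = inj₁ d
      ... | inj₂ (ts , gs , ls) = inj₂ (root ts ,
              All.tabulate (λ h → from (truth gs ls _ (t⊆X h)) h) ,
              All.tabulate (λ m f → let D∈X , ¬h = outside⁻ X t m in ¬h (to (truth gs ls _ D∈X) f)))

    -- Induction on the number of formulas of `X` missing from `t`, which drops because the oracle
    -- is consulted only at proper extensions.
    saturate : ∀ n t → t ⊆ X → length (outside X t) < n → Verdict t (outside X t)
    saturate (suc n) t t⊆X (s≤s b) = saturate-step t
      (λ t′ s s′ C∈X ¬h h → saturate n t′ s′ (<-≤-trans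
        (length-filter-strict _ _ (λ _ D∉t′ D∈t → D∉t′ (s D∈t)) X C∈X ¬h (λ C∉t′ → C∉t′ h)) b)) t⊆X

  decide : ∀ Γ G → (Γ ⊢ G) ⊎ Σ Tree λ w → All (w ⊩_) Γ × ¬ w ⊩ G
  decide Γ G with split X Γ (G ∷ []) (λ t _ s → saturate _ t s ≤-refl) Γ⊆X
                    (λ { (here refl) → ∈-++⁺ˡ (self∈subs G) }) id (inj₂ ∘ inj₂)
    where
    X* : List Form → List Form
    X* = foldr (λ D → subs D ++_) []
    X = subs G ++ X* Γ
    X*-closed : ∀ Δ → Closed (X* Δ)
    X*-closed []      ()
    X*-closed (D ∷ Δ) = ++-closed (subs-closed D) (X*-closed Δ)
    Γ⊆X* : ∀ Δ → Δ ⊆ X* Δ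
    Γ⊆X* (D ∷ Δ) (here refl) = ∈-++⁺ˡ (self∈subs D)
    Γ⊆X* (D ∷ Δ) (there m)   = ∈-++⁺ʳ (subs D) (Γ⊆X* Δ m)
    Γ⊆X : Γ ⊆ X
    Γ⊆X m = ∈-++⁺ʳ (subs G) (Γ⊆X* Γ m)
    open Saturation X (++-closed (subs-closed G) (X*-closed Γ))
  ... | inj₁ d = inj₁ (∨E d (hyp (here refl)) (⊥E (hyp (here refl))))
  ... | inj₂ (w , f , (¬g ∷ [])) = inj₂ (w , f , ¬g)

  _⊢?_ : ∀ Γ G → Dec (Γ ⊢ G)
  Γ ⊢? G with decide Γ G
  ... | inj₁ d = yes d
  ... | inj₂ (w , f , ¬g) = no λ d → ¬g (sound d w f)

  complete : ∀ {E C} → (∀ w → w ⊩ E → w ⊩ C) → IPC+ E ⊢ C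
  complete {E} {C} v with decide (E ∷ []) C
  ... | inj₁ d = ⇒I d
  ... | inj₂ (w , (e ∷ []) , ¬c) = contradiction (v w e) ¬c

  -- Substitutions fixing a formula

  private
    Sub = Subst {nv} {np}

  apply-∘ : ∀ (γ θ : Sub) D → apply γ (apply θ D) ≡ apply (γ ∘ˢ θ) D
  apply-∘ γ θ (var x)  = refl
  apply-∘ γ θ (par p)  = refl
  apply-∘ γ θ ⊥'       = refl
  apply-∘ γ θ (C ∧' D) = cong₂ _∧'_ (apply-∘ γ θ C) (apply-∘ γ θ D)
  apply-∘ γ θ (C ∨' D) = cong₂ _∨'_ (apply-∘ γ θ C) (apply-∘ γ θ D)
  apply-∘ γ θ (C ⇒ D)  = cong₂ _⇒_ (apply-∘ γ θ C) (apply-∘ γ θ D)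

  apply-var : ∀ (D : Form) → apply var D ≡ D
  apply-var (var x)  = refl
  apply-var (par p)  = refl
  apply-var ⊥'       = refl
  apply-var (C ∧' D) = cong₂ _∧'_ (apply-var C) (apply-var D)
  apply-var (C ∨' D) = cong₂ _∨'_ (apply-var C) (apply-var D)
  apply-var (C ⇒ D)  = cong₂ _⇒_ (apply-var C) (apply-var D)

  apply-parOnly : ∀ (θ : Sub) {D} → ParOnly D → apply θ D ≡ D
  apply-parOnly θ (par p)  = refl
  apply-parOnly θ ⊥'       = refl
  apply-parOnly θ (c ∧' d) = cong₂ _∧'_ (apply-parOnly θ c) (apply-parOnly θ d)
  apply-parOnly θ (c ∨' d) = cong₂ _∨'_ (apply-parOnly θ c) (apply-parOnly θ d)
  apply-parOnly θ (c ⇒ d)  = cong₂ _⇒_ (apply-parOnly θ c) (apply-parOnly θ d)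

  ⊩-resp-≡ : ∀ (γ : Sub) {w} F G → F ≡ G → (w ⊩ apply γ F) ⟺ (w ⊩ apply γ G)
  ⊩-resp-≡ γ _ _ refl = ⇔-id _

  ⊩⋀ : ∀ (θ : Sub) {w} Δ → (w ⊩ apply θ (⋀ Δ)) ⟺ All (λ D → w ⊩ apply θ D) Δ
  ⊩⋀ θ []      = mk⇔ (λ _ → []) (λ _ u p b → b)
  ⊩⋀ θ (D ∷ Δ) = mk⇔ (λ (d , f) → d ∷ to (⊩⋀ θ Δ) f) (λ { (d ∷ f) → d , from (⊩⋀ θ Δ) f })

  ⊩⋁ : ∀ (θ : Sub) {w} Δ → (w ⊩ apply θ (⋁ Δ)) ⟺ Any (λ D → w ⊩ apply θ D) Δ
  ⊩⋁ θ []      = mk⇔ (λ ()) (λ ())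
  ⊩⋁ θ (D ∷ Δ) = mk⇔ [ here , there ∘ to (⊩⋁ θ Δ) ]′
                     (λ { (here d) → inj₁ d ; (there f) → inj₂ (from (⊩⋁ θ Δ) f) })

  open DecMembership (Fin._≟_ {nv}) using () renaming (_∈?_ to _∈ᵛ?_)

  module Projection (B : Form) where

    -- Ghilardi's substitution: identity modulo B; at points not forcing B it resets the
    -- variables to those in a, as far as persistence into the B-points allows.
    σ : List (Fin nv) → Sub
    σ a x with x ∈ᵛ? a
    ... | yes _ = B ⇒ var x
    ... | no _  = B ∧' var x

    -- Where `B` is true, both `B ⇒ var x` and `B ∧' var x` collapse to `var x`; persistence of `B`
    -- carries this through implications.
    σ-inside : ∀ θ a {w} → w ⊩ apply θ B → ∀ D → (w ⊩ apply (θ ∘ˢ σ a) D) ⟺ (w ⊩ apply θ D)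
    σ-inside θ a b (var x) with x ∈ᵛ? a
    ... | yes _ = mk⇔ (λ f → f _ here b) (λ f u p _ → persist (θ x) p f)
    ... | no _  = mk⇔ proj₂ (b ,_)
    σ-inside θ a b (par p)  = ⇔-id _
    σ-inside θ a b ⊥'       = ⇔-id _
    σ-inside θ a b (C ∧' D) = mk⇔
      (λ (c , d) → to (σ-inside θ a b C) c , to (σ-inside θ a b D) d)
      (λ (c , d) → from (σ-inside θ a b C) c , from (σ-inside θ a b D) d)
    σ-inside θ a b (C ∨' D) = mk⇔
      [ inj₁ ∘ to (σ-inside θ a b C) , inj₂ ∘ to (σ-inside θ a b D) ]′
      [ inj₁ ∘ from (σ-inside θ a b C) , inj₂ ∘ from (σ-inside θ a b D) ]′
    σ-inside θ a b (C ⇒ D)  = mk⇔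
      (λ f u p c → let b′ = persist (apply θ B) p b in to (σ-inside θ a b′ D) (f u p (from (σ-inside θ a b′ C) c)))
      (λ f u p c → let b′ = persist (apply θ B) p b in from (σ-inside θ a b′ D) (f u p (to (σ-inside θ a b′ C) c)))

    σ-outside : ∀ θ a {w} → ¬ w ⊩ apply θ B → ∀ x →
                (w ⊩ apply θ (σ a x)) ⟺ (x ∈ a × (∀ u → u ≽ w → u ⊩ apply θ B → u ⊩ θ x))
    σ-outside θ a ¬b x with x ∈ᵛ? a
    ... | yes h = mk⇔ (λ f → h , f) proj₂
    ... | no ¬h = mk⇔ (λ f → contradiction (proj₁ f) ¬b) (λ f → contradiction (proj₁ f) ¬h)

    -- Composition is on the right, so on a model `θ` acts first and the `σ a` follow in the order
    -- of the list.
    run : Sub → List (List (Fin nv)) → Sub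
    run θ []      = θ
    run θ (a ∷ l) = run (θ ∘ˢ σ a) l

    run-inside : ∀ θ l {w} → w ⊩ apply θ B → ∀ D → (w ⊩ apply (run θ l) D) ⟺ (w ⊩ apply θ D)
    run-inside θ []      b D = ⇔-id _
    run-inside θ (a ∷ l) b D =
      ⟺-trans (run-inside (θ ∘ˢ σ a) l (from (σ-inside θ a b B) b) D) (σ-inside θ a b D)

    rounds : ℕ → Sub
    rounds zero    = var
    rounds (suc i) = run (rounds i) (subsets (allFin nv))

    module _ (γ : Sub) {w} (b : w ⊩ apply γ B) where

      -- Semantic form of being the identity modulo `B`. At variables it says that `γ` factors
      -- through `θ`, which is what generality requires.
      Absorbs : Sub → Set
      Absorbs θ = ∀ D → (w ⊩ apply γ (apply θ D)) ⟺ (w ⊩ apply γ D)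

      run-absorbs : ∀ θ l → Absorbs θ → Absorbs (run θ l)
      run-absorbs θ []      h = h
      run-absorbs θ (a ∷ l) h = run-absorbs (θ ∘ˢ σ a) l λ D →
        subst (λ F → (w ⊩ apply γ F) ⟺ (w ⊩ apply γ D)) (apply-∘ θ (σ a) D)
          (⟺-trans (h (apply (σ a) D))
            (subst (λ F → (w ⊩ F) ⟺ (w ⊩ apply γ D)) (sym (apply-∘ γ (σ a) D)) (σ-inside γ a b D)))

      rounds-absorbs : ∀ i → Absorbs (rounds i)
      rounds-absorbs zero    D = ⊩-resp-≡ γ (apply var D) D (apply-var D)
      rounds-absorbs (suc i) = run-absorbs (rounds i) (subsets (allFin nv)) (rounds-absorbs i)

  -- Stable points and their passage into `B`.

  module Extension (X : List Form) (closed : Closed X)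
                   (var∈X : ∀ x → var x ∈ X) (par∈X : ∀ p → par p ∈ X) (Q : List (List Form)) where

    inside : List Form → List Form
    inside t = filter (_∈? t) X

    -- Forced at w iff no point above w has X-theory t.
    block : List Form → Form
    block t = ⋀ (inside t) ⇒ ⋁ (outside X t)

    B : Form
    B = ⋀ (map block Q)

    open Projection B public

    ⊩B : ∀ θ {w} → (w ⊩ apply θ B) ⟺ (∀ t → t ∈ Q → w ⊩ apply θ (block t))
    ⊩B θ {w} = mk⇔ (λ b t m → All.lookup (to (⊩⋀ θ _) b) (∈-map⁺ block m))
      λ f → from (⊩⋀ θ _) (All.tabulate λ m → let t , t∈Q , eq = ∈-map⁻ block m in
                                               subst (λ F → w ⊩ apply θ F) (sym eq) (f t t∈Q))

    -- The finite stock of possible data about a point: theories of `B`-points above it, and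
    -- parameters it does not force. Its length bounds the measure `μ`.
    items : List (List Form ⊎ Fin np)
    items = map inj₁ (subsets X) ++ map inj₂ (allFin np)

    Type : Sub → Tree → List Form → Set
    Type θ u t = All (λ D → (u ⊩ apply θ D) ⟺ D ∈ t) X

    type : Sub → Tree → List Form
    type θ u = filter (λ D → u ⊩? apply θ D) X

    type-Type : ∀ θ u → Type θ u (type θ u)
    type-Type θ u = All.tabulate λ m → mk⇔ (∈-filter⁺ (λ D → u ⊩? apply θ D) m)
                                           (proj₂ ∘ ∈-filter⁻ (λ D → u ⊩? apply θ D) {xs = X})

    Holds : Sub → Tree → List Form ⊎ Fin np → Set
    Holds θ w (inj₁ t) = Σ Tree λ u → u ≽ w × (u ⊩ apply θ B × Type θ u t)
    Holds θ w (inj₂ p) = ¬ w ⊩ par p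

    Holds? : ∀ θ w → Decidable (Holds θ w)
    Holds? θ w (inj₁ t) = any≽? (λ u → (u ⊩? apply θ B) ×-dec All.all? (λ D →
      map′ (λ (f , g) → mk⇔ f g) (λ e → to e , from e)
        (((u ⊩? apply θ D) →-dec (D ∈? t)) ×-dec ((D ∈? t) →-dec (u ⊩? apply θ D)))) X) w
    Holds? θ w (inj₂ p) = ¬? (w ⊩? par p)

    Holds-antitone : ∀ θ {u w} → u ≽ w → ∀ i → Holds θ u i → Holds θ w i
    Holds-antitone θ p (inj₁ t) (z , q , h) = z , ≽-trans q p , h
    Holds-antitone θ p (inj₂ x) h f = h (persist (par x) p f)

    -- Points already forcing `B` keep their whole theory, and forcing of parameters does not depend
    -- on the substitution.
    Holds-run : ∀ θ l {w} i → Holds θ w i → Holds (run θ l) w i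
    Holds-run θ l (inj₁ t) (u , p , b , ty) = u , p , from (run-inside θ l b B) b ,
      All.map (λ {D} e → ⟺-trans (run-inside θ l b D) e) ty
    Holds-run θ l (inj₂ p) h = h

    μ : Sub → Tree → ℕ
    μ θ w = length (filter (Holds? θ w) items)

    -- As items can only be lost on the way up, this makes all points above `w` that do not force
    -- `B` hold exactly the same `items` as `w`.
    Stable : Sub → Tree → Set
    Stable θ w = ∀ u → u ≽ w → ¬ u ⊩ apply θ B → ∀ i → i ∈ items → Holds θ w i → Holds θ u i

    -- An item lost at a point not forcing `B` strictly lowers `μ` there, so searching for a smaller
    -- `μ` suffices.
    stable? : ∀ θ w → Stable θ w ⊎ Σ Tree λ u → u ≽ w × (¬ u ⊩ apply θ B) × μ θ u < μ θ w
    stable? θ w with any≽? (λ u → ¬? (u ⊩? apply θ B) ×-dec (μ θ u <? μ θ w)) w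
    ... | yes d = inj₂ d
    ... | no ¬d = inj₁ λ u p ¬b i m h → decidable-stable (Holds? θ u i) λ ¬h →
      ¬d (u , p , ¬b , length-filter-strict (Holds? θ u) (Holds? θ w) (Holds-antitone θ p) items m h ¬h)

    stable-type : ∀ {θ w} → Stable θ w → ∀ {u} → u ≽ w → ¬ u ⊩ apply θ B → ∀ {z} → z ≽ w → z ⊩ apply θ B →
                  Σ Tree λ z′ → z′ ≽ u × z′ ⊩ apply θ B ×
                                (∀ {D} → D ∈ X → (z ⊩ apply θ D) ⟺ (z′ ⊩ apply θ D))
    stable-type {θ} st {u} p ¬b {z} q b =
      let z′ , q′ , b′ , ty = st u p ¬b (inj₁ (type θ z)) (∈-++⁺ˡ (∈-map⁺ inj₁ (filter∈subsets _ X)))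
                                 (z , q , b , type-Type θ z)
      in z′ , q′ , b′ , λ m → ⟺-trans (All.lookup (type-Type θ z) m) (⟺-sym (All.lookup ty m))

    stable-par : ∀ {θ w} → Stable θ w → ∀ {u} → u ≽ w → ¬ u ⊩ apply θ B → ∀ p → u ⊩ par p → w ⊩ par p
    stable-par {θ} {w} st {u} q ¬b p f = decidable-stable (w ⊩? par p) λ ¬f →
      st u q ¬b (inj₂ p) (∈-++⁺ʳ (map inj₁ (subsets X)) (∈-map⁺ inj₂ (∈-allFin p))) ¬f f

    Above : Sub → Tree → Form → Set
    Above θ w D = ∀ u → u ≽ w → u ⊩ apply θ B → u ⊩ apply θ D

    -- The theory of a new root placed below the B-points above w,
    -- with the parameters of w and the variables in a.
    Root : Sub → Tree → List (Fin nv) → Form → Set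
    Root θ w a (var x)  = x ∈ a × Above θ w (var x)
    Root θ w a (par p)  = w ⊩ par p
    Root θ w a ⊥'       = ⊥
    Root θ w a (C ∧' D) = Root θ w a C × Root θ w a D
    Root θ w a (C ∨' D) = Root θ w a C ⊎ Root θ w a D
    Root θ w a (C ⇒ D)  = (Root θ w a C → Root θ w a D) × Above θ w (C ⇒ D)

    -- The right side does not mention `u`: one step gives all points above `w` outside `B` a common
    -- theory on `X`. For implications, stability replaces any `B`-point above `w` by one above `u`
    -- with the same theory, and the remaining points are handled by induction.
    stable-root : ∀ {θ w} a → Stable θ w → ∀ D → D ∈ X → ∀ {u} → u ≽ w → ¬ u ⊩ apply θ B →
                  (u ⊩ apply (θ ∘ˢ σ a) D) ⟺ Root θ w a D
    stable-root {θ} {w} a st = go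
      where
      go : ∀ D → D ∈ X → ∀ {u} → u ≽ w → ¬ u ⊩ apply θ B → (u ⊩ apply (θ ∘ˢ σ a) D) ⟺ Root θ w a D
      go (var x) m p ¬b = mk⇔
        (λ f → let h , g = to (σ-outside θ a ¬b x) f in h , λ z q b →
          let z′ , q′ , b′ , e = stable-type st p ¬b q b in from (e m) (g z′ q′ b′))
        (λ (h , g) → from (σ-outside θ a ¬b x) (h , λ z q → g z (≽-trans q p)))
      go (par x) m p ¬b = mk⇔ (stable-par st p ¬b x) (persist (par x) p)
      go ⊥' m p ¬b = ⇔-id _
      go (C ∧' D) m p ¬b = mk⇔
        (λ (c , d) → to (go C (closed m (here refl)) p ¬b) c ,
                     to (go D (closed m (there (here refl))) p ¬b) d)
        (λ (c , d) → from (go C (closed m (here refl)) p ¬b) c ,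
                     from (go D (closed m (there (here refl))) p ¬b) d)
      go (C ∨' D) m p ¬b = mk⇔
        [ inj₁ ∘ to (go C (closed m (here refl)) p ¬b) ,
          inj₂ ∘ to (go D (closed m (there (here refl))) p ¬b) ]′
        [ inj₁ ∘ from (go C (closed m (here refl)) p ¬b) ,
          inj₂ ∘ from (go D (closed m (there (here refl))) p ¬b) ]′
      go (C ⇒ D) m {u} p ¬b = mk⇔
        (λ f → (λ c → to (goD p ¬b) (f u here (from (goC p ¬b) c))) ,
               λ z q b → let z′ , q′ , b′ , e = stable-type st p ¬b q b in
                         from (e m) (to (σ-inside θ a b′ (C ⇒ D)) (persist (apply (θ ∘ˢ σ a) (C ⇒ D)) q′ f)))
        bwd
        where
        goC : ∀ {u} → u ≽ w → ¬ u ⊩ apply θ B → _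
        goC = go C (closed m (here refl))
        goD : ∀ {u} → u ≽ w → ¬ u ⊩ apply θ B → _
        goD = go D (closed m (there (here refl)))
        bwd : Root θ w a (C ⇒ D) → u ⊩ apply (θ ∘ˢ σ a) (C ⇒ D)
        bwd (r , above) z q c with z ⊩? apply θ B
        ... | yes b   = from (σ-inside θ a b (C ⇒ D)) (above z (≽-trans q p) b) z here c
        ... | no ¬b′ = from (goD (≽-trans q p) ¬b′) (r (to (goC (≽-trans q p) ¬b′) c))

    -- Only the theory of `M` on `X` matters, so the tree and the substitution realising it need not
    -- be related to `w` or `θ`.
    Good : Sub → Tree → List (Fin nv) → Set
    Good θ w a = Σ Tree λ M → Σ Sub λ δ →
      M ⊩ apply δ B × (∀ {D} → D ∈ X → Root θ w a D ⟺ (M ⊩ apply δ D))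

    -- A block speaks only about a theory on `X`. Points above `w` outside `B` acquire the theory of
    -- `M`, which satisfies every block; the others satisfied them before.
    good-enters : ∀ {θ w a} → Stable θ w → Good θ w a → w ⊩ apply (θ ∘ˢ σ a) B
    good-enters {θ} {w} {a} st (M , δ , bM , agree) = from (⊩B (θ ∘ˢ σ a)) go
      where
      go : ∀ t → t ∈ Q → w ⊩ apply (θ ∘ˢ σ a) (block t)
      go t t∈Q z p f with z ⊩? apply θ B
      ... | yes b = to (⊩B (θ ∘ˢ σ a)) (from (σ-inside θ a b B) b) t t∈Q z here f
      ... | no ¬b =
        let e  : ∀ {D} → D ∈ X → (z ⊩ apply (θ ∘ˢ σ a) D) ⟺ (M ⊩ apply δ D)
            e  = λ {D} m → ⟺-trans (stable-root a st D m p ¬b) (agree m)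
            f′ = All.tabulate λ m →
                   to (e (proj₁ (∈-filter⁻ (_∈? t) {xs = X} m))) (All.lookup (to (⊩⋀ _ (inside t)) f) m)
            D , m , d = find (to (⊩⋁ δ (outside X t)) (to (⊩B δ) bM t t∈Q M here (from (⊩⋀ δ (inside t)) f′)))
        in from (⊩⋁ _ (outside X t)) (lose m (from (e (proj₁ (outside⁻ X t m))) d))

    -- A stable w stays stable, over the same B-points, until it forces B: the points above w
    -- not forcing B share one X-theory after each step, so they start forcing B simultaneously.
    good-run : ∀ {a} l → a ∈ l → ∀ {θ w} → Stable θ w → Good θ w a → w ⊩ apply (run θ l) B
    good-run {a} (b ∷ l) a∈ {θ} {w} st good with w ⊩? apply (θ ∘ˢ σ b) B | a∈
    ... | yes h | _          = from (run-inside _ l h B) h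
    ... | no ¬h | here refl  = contradiction (good-enters st good) ¬h
    ... | no ¬h | there a∈l = good-run l a∈l stable′ good′
      where
      θ′ = θ ∘ˢ σ b

      same : ∀ {u} → u ≽ w → (u ⊩ apply θ′ B) ⟺ (u ⊩ apply θ B)
      same {u} p = mk⇔ fwd (λ h → from (σ-inside θ b h B) h)
        where
        fwd : u ⊩ apply θ′ B → u ⊩ apply θ B
        fwd h = decidable-stable (u ⊩? apply θ B) λ ¬b →
          -- Had `u` newly entered `B`, then `u` under `θ′` would itself witness that `b` is good,
          -- and `w` would have entered too.
          ¬h (good-enters st (u , θ′ , h , λ {D} m → ⟺-sym (stable-root b st D m p ¬b)))

      holds : ∀ {u} → u ≽ w → ∀ i → Holds θ′ u i ⟺ Holds θ u i
      holds p (inj₁ t) = mk⇔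
        (λ (z , q , h , ty) → let h′ = to (same (≽-trans q p)) h in
           z , q , h′ , All.map (λ {D} e → ⟺-trans (⟺-sym (σ-inside θ b h′ D)) e) ty)
        (Holds-run θ (b ∷ []) (inj₁ t))
      holds p (inj₂ x) = ⇔-id _

      stable′ : Stable θ′ w
      stable′ u p ¬b i m h = from (holds p i)
        (st u p (¬b ∘ from (same p)) i m (to (holds here i) h))

      above : ∀ D → Above θ′ w D ⟺ Above θ w D
      above D = mk⇔
        (λ f u p h → to (σ-inside θ b h D) (f u p (from (same p) h)))
        (λ f u p h → let h′ = to (same p) h in from (σ-inside θ b h′ D) (f u p h′))

      root-same : ∀ D → Root θ′ w a D ⟺ Root θ w a D
      root-same (var x)  = mk⇔ (map₂ (to (above (var x)))) (map₂ (from (above (var x))))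
      root-same (par p)  = ⇔-id _
      root-same ⊥'       = ⇔-id _
      root-same (C ∧' D) = mk⇔
        (λ (c , d) → to (root-same C) c , to (root-same D) d)
        (λ (c , d) → from (root-same C) c , from (root-same D) d)
      root-same (C ∨' D) = mk⇔
        [ inj₁ ∘ to (root-same C) , inj₂ ∘ to (root-same D) ]′
        [ inj₁ ∘ from (root-same C) , inj₂ ∘ from (root-same D) ]′
      root-same (C ⇒ D)  = mk⇔
        (λ (r , f) → (to (root-same D) ∘ r ∘ from (root-same C)) , to (above (C ⇒ D)) f)
        (λ (r , f) → (from (root-same D) ∘ r ∘ to (root-same C)) , from (above (C ⇒ D)) f)

      good′ : Good θ′ w a
      good′ = let M , δ , bM , agree = good in
              M , δ , bM , λ {D} m → ⟺-trans (root-same D) (agree m)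

    -- A point left outside `B` after `i` rounds has `μ` at least `i`, while `μ` never exceeds
    -- `length items`; one more round than that leaves no such point.
    mgu : Sub
    mgu = rounds (suc (length items))

    Agree : Sub → Tree → Sub → Tree → Set
    Agree θ u γ m = ∀ {D} → D ∈ X → (u ⊩ apply θ D) ⟺ (m ⊩ apply γ D)

    -- Gluing models of `γ`: projectivity of `B` modulo `E`.

    module _ {E : Form} (E-par : ParOnly E) (E∈X : E ∈ X) (γ : Sub)
             (realise : ∀ θ u → u ⊩ apply θ B → Σ Tree (Agree θ u γ))
             (γ⊩B : ∀ M → M ⊩ E → M ⊩ apply γ B) where

      -- Both directions are recorded: every `B`-point has a counterpart below the future root, and
      -- nothing else is placed there.
      collect : ∀ θ (us : List Tree) → Σ (List Tree) λ ts →
                (∀ {u} → u ∈ us → u ⊩ apply θ B → Σ Tree λ m → m ∈ ts × Agree θ u γ m) ×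
                (∀ {m} → m ∈ ts → Σ Tree λ u → u ∈ us × u ⊩ apply θ B × Agree θ u γ m)
      collect θ [] = [] , (λ ()) , (λ ())
      collect θ (u ∷ us) with collect θ us | u ⊩? apply θ B
      ... | ts , up , down | no ¬b = ts ,
        (λ { (here refl) b → contradiction b ¬b ; (there m) → up m }) ,
        (λ m → let z , z∈ , r = down m in z , there z∈ , r)
      ... | ts , up , down | yes b = let m , e = realise θ u b in m ∷ ts ,
        (λ { (here refl) _ → m , here refl , e
           ; (there h) b′ → let m′ , m′∈ , e′ = up h b′ in m′ , there m′∈ , e′ }) ,
        (λ { (here refl) → u , here refl , b , e
           ; (there h) → let z , z∈ , r = down h in z , there z∈ , r })

      -- Glue the counterparts of the `B`-points above `w` under a new root `M` with the parameters
      -- of `w`. This is a model of `E`, so `γ` makes `B` true at `M`, and `a` is read off from the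
      -- variables that `γ` makes true there.
      good : ∀ {θ w} → Stable θ w → w ⊩ E → ¬ w ⊩ apply θ B →
             Σ (List (Fin nv)) λ a → a ∈ subsets (allFin nv) × Good θ w a
      good {θ} {w} st we ¬b = a , filter∈subsets _ (allFin nv) , M , γ , γ⊩B M M⊩E , λ {D} → go D
        where
        glued = collect θ (points w)
        ts = proj₁ glued
        up = proj₁ (proj₂ glued)
        down = proj₂ (proj₂ glued)

        M : Tree
        -- The variable labels of the new root may be chosen arbitrarily, since `M` is only
        -- evaluated through `γ` and `a` is determined afterwards.
        M = node (λ _ → false) (λ p → ⌊ w ⊩? par p ⌋) ts

        a : List (Fin nv)
        a = filter (λ x → M ⊩? γ x) (allFin nv)

        above : ∀ D → D ∈ X → M ⊩ apply γ D → Above θ w D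
        above D m f u p b = let s , s∈ , e = up (points⁺ p) b in
          from (e m) (persist (apply γ D) (there s∈ here) f)

        below : ∀ {D s} → D ∈ X → Above θ w D → s ∈ ts → s ⊩ apply γ D
        below m g s∈ = let u , u∈ , b , e = down s∈ in to (e m) (g u (points⁻ w u∈) b)

        go : ∀ D → D ∈ X → Root θ w a D ⟺ (M ⊩ apply γ D)
        go (var x) m = mk⇔ (λ (h , _) → proj₂ (∈-filter⁻ (λ x → M ⊩? γ x) {xs = allFin nv} h))
                           (λ f → ∈-filter⁺ (λ x → M ⊩? γ x) (∈-allFin x) f , above (var x) m f)
        go (par p) m = mk⇔
          (λ f → λ { _ here → fromWitness f
                   ; z (there s∈ q) → below m (λ u r _ → persist (par p) r f) s∈ z q })
          (λ f → toWitness (f M here))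
        go ⊥' m = ⇔-id _
        go (C ∧' D) m = mk⇔
          (λ (c , d) → to (go C (closed m (here refl))) c , to (go D (closed m (there (here refl)))) d)
          (λ (c , d) → from (go C (closed m (here refl))) c , from (go D (closed m (there (here refl)))) d)
        go (C ∨' D) m = mk⇔
          [ inj₁ ∘ to (go C (closed m (here refl))) , inj₂ ∘ to (go D (closed m (there (here refl)))) ]′
          [ inj₁ ∘ from (go C (closed m (here refl))) , inj₂ ∘ from (go D (closed m (there (here refl)))) ]′
        go (C ⇒ D) m = mk⇔
          (λ (r , g) → λ { _ here c → to (go D (closed m (there (here refl))))
                                        (r (from (go C (closed m (here refl))) c))
                         ; z (there s∈ q) → below m g s∈ z q })
          (λ f → (λ c → from (go D (closed m (there (here refl)))) (f M here (to (go C (closed m (here refl))) c))) ,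
                 above (C ⇒ D) m f)

        M⊩E : M ⊩ E
        -- Substitutions fix `E`, so `E` passes from `w` into the common theory `Root θ w a`, and
        -- from there to `M`.
        M⊩E = subst (M ⊩_) (apply-parOnly γ E-par)
          (to (go E E∈X) (to (stable-root a st E E∈X here ¬b)
            (subst (w ⊩_) (sym (apply-parOnly (θ ∘ˢ σ a) E-par)) we)))

      -- One round repairs the stable points; any other point lies below one of smaller μ that
      -- was not repaired in the earlier rounds, and Holds never loses items.
      rounds-μ : ∀ i w → w ⊩ E → ¬ w ⊩ apply (rounds i) B → i ≤ μ (rounds i) w
      rounds-μ zero    w we ¬b = z≤n
      rounds-μ (suc i) w we ¬b with stable? (rounds i) w
      ... | inj₂ (u , p , ¬b′ , lt) = ≤-trans (s≤s (rounds-μ i u (persist E p we) ¬b′)) (≤-trans lt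
              (length-filter-mono (Holds? (rounds i) w) (Holds? (rounds (suc i)) w) (Holds-run (rounds i) (subsets (allFin nv))) items))
      ... | inj₁ st with w ⊩? apply (rounds i) B
      ...   | yes b = contradiction (from (run-inside (rounds i) (subsets (allFin nv)) b B) b) ¬b
      ...   | no ¬b′ = let a , a∈ , g = good st we ¬b′ in contradiction (good-run (subsets (allFin nv)) a∈ st g) ¬b

      mgu⊩B : ∀ w → w ⊩ E → w ⊩ apply mgu B
      mgu⊩B w we = decidable-stable (w ⊩? apply mgu B) λ ¬b →
        <-irrefl refl (≤-trans (rounds-μ _ w we ¬b) (length-filter (Holds? mgu w) items))

  -- The finite complete set of unifiers.

  module _ (E : Form) (E-par : ParOnly E) (A : Form) where

    private
      atoms = map var (allFin nv) ++ map par (allFin np)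
      X = (subs A ++ subs E) ++ atoms

      atoms-closed : Closed atoms
      atoms-closed m c with ∈-++⁻ (map var (allFin nv)) m
      ... | inj₁ h with ∈-map⁻ var h
      ...   | _ , _ , refl = contradiction c λ ()
      atoms-closed m c | inj₂ h with ∈-map⁻ par h
      ...   | _ , _ , refl = contradiction c λ ()

      module Ext = Extension X (++-closed (++-closed (subs-closed A) (subs-closed E)) atoms-closed)
        (λ x → ∈-++⁺ʳ (subs A ++ subs E) (∈-++⁺ˡ (∈-map⁺ var (∈-allFin x))))
        (λ p → ∈-++⁺ʳ (subs A ++ subs E) (∈-++⁺ʳ (map var (allFin nv)) (∈-map⁺ par (∈-allFin p))))

      A∈X : A ∈ X
      A∈X = ∈-++⁺ˡ (∈-++⁺ˡ (self∈subs A))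

      E∈X : E ∈ X
      E∈X = ∈-++⁺ˡ (∈-++⁺ʳ (subs A) (self∈subs E))

      unifier? : ∀ θ → Dec (Unifier E A θ)
      unifier? θ = [] ⊢? (E ⇒ apply θ A)

    module _ (γ : Sub) (γ-unifies : Unifier E A γ) where

      -- `inside` is the same for every `Q`; the instance at `[]` makes it available for defining
      -- the actual `Q`.
      open Ext [] using (inside)

      -- γ unifies A, so by this choice of Q it unifies B, and B excludes every theory without A.
      Blocked : List Form → Set
      Blocked t = (E ∷ apply γ (⋀ (inside t)) ∷ []) ⊢ apply γ (⋁ (outside X t))

      blocked? : Decidable Blocked
      blocked? t = _ ⊢? _

      Q : List (List Form)
      Q = filter blocked? (subsets X)

      open Ext Q hiding (inside)

      γ⊩B : ∀ M → M ⊩ E → M ⊩ apply γ B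
      γ⊩B M e = from (⊩B γ) λ t t∈Q u p f →
        sound (proj₂ (∈-filter⁻ blocked? {xs = subsets X} t∈Q)) u (persist E p e ∷ f ∷ [])

      -- A point forcing `B` has a theory outside `Q`, hence not blocked, and the countermodel
      -- showing this is a model of `E` with exactly that theory under `γ`.
      realise : ∀ θ u → u ⊩ apply θ B → Σ Tree λ m → m ⊩ E × Agree θ u γ m
      realise θ u b with decide (E ∷ apply γ (⋀ (inside (type θ u))) ∷ []) (apply γ (⋁ (outside X (type θ u))))
      ... | inj₂ (m , (e ∷ f ∷ []) , ¬g) = m , e , λ {D} D∈X → let ty = All.lookup (type-Type θ u) D∈X in mk⇔
        (λ d → All.lookup (to (⊩⋀ γ (inside (type θ u))) f) (∈-filter⁺ (_∈? type θ u) D∈X (to ty d)))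
        (λ d → decidable-stable (u ⊩? apply θ D) λ ¬d →
          ¬g (from (⊩⋁ γ _) (lose (outside⁺ D∈X (¬d ∘ from ty)) d)))
      ... | inj₁ d = ⊥-elim (let D , m , h = find (to (⊩⋁ θ (outside X t)) g) ; D∈X , D∉t = outside⁻ X t m in
                             D∉t (to (All.lookup (type-Type θ u) D∈X) h))
        where
        t = type θ u
        t∈Q : t ∈ Q
        t∈Q = ∈-filter⁺ blocked? (filter∈subsets _ X) d
        g : u ⊩ apply θ (⋁ (outside X t))
        g = to (⊩B θ) b t t∈Q u here (from (⊩⋀ θ (inside t)) (All.tabulate λ m →
              let D∈X , D∈t = ∈-filter⁻ (_∈? t) {xs = X} m in from (All.lookup (type-Type θ u) D∈X) D∈t))

      -- Under `mgu` each model of `E` forces `B`, so it shares its theory on `X`, which includes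
      -- `A`, with a model of `E` under `γ`.
      mgu-unifies : Unifier E A mgu
      mgu-unifies = complete λ w e →
        let m , me , agree = realise mgu w (mgu⊩B E-par E∈X γ (λ θ u b → map₂ proj₂ (realise θ u b)) γ⊩B w e)
        in from (agree A∈X) (sound γ-unifies m [] m here me)

      -- The mediating substitution is `γ` itself: it unifies `B`, modulo which `mgu` is the
      -- identity.
      γ-lessGeneral : LessGeneral E γ mgu
      γ-lessGeneral = γ , λ x → complete λ w e →
        (λ u p f → from (rounds-absorbs γ (γ⊩B u (persist E p e)) (suc (length items)) (var x)) f) ,
        (λ u p f → to (rounds-absorbs γ (γ⊩B u (persist E p e)) (suc (length items)) (var x)) f)

      Q∈ : Q ∈ subsets (subsets X)
      Q∈ = filter∈subsets blocked? (subsets X)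

    completeSet : Σ (List Sub) (CompleteSet E A)
    completeSet = filter unifier? candidates ,
      All.tabulate (λ m → proj₂ (∈-filter⁻ unifier? {xs = candidates} m)) ,
      λ γ γ-unifies → lose (∈-filter⁺ unifier? (∈-map⁺ (λ Q → Ext.mgu Q) (Q∈ γ γ-unifies))
                                      (mgu-unifies γ γ-unifies))
                           (γ-lessGeneral γ γ-unifies)
      where
      -- The candidates depend on `X` alone and not on `γ`. For an arbitrary `Q` the substitution
      -- may fail to unify `A`, hence the filter.
      candidates = map (λ Q → Ext.mgu Q) (subsets (subsets X))

theorem5p7 : (nv np : ℕ) (E : Fm nv np) → ParOnly E → Finitary E
theorem5p7 nv np E E-par A _ = completeSet E E-par A
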